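{- Let $\Gamma$ be a presheaf on $\mathbb{T}$, let $X$ be a family over $\Gamma$, let $\varphi$ be a predicate over $(\Gamma.X)\times\mathrm{Clk}$, and let $n:\Gamma\to\mathbb{N}$ be a morphism of presheaves into the constant presheaf $\mathbb{N}$. Suppose that for all $(\mathcal{E},\vartheta)$, $\gamma\in\Gamma(\mathcal{E},\vartheta)$, $x,y\in X(\mathcal{E},\vartheta,\gamma)$ and $\lambda\in\mathcal{E}$, if $\star\in\varphi(\mathcal{E},\vartheta,\gamma,x,\lambda)$ and $\star\in\varphi(\mathcal{E},\vartheta,\gamma,y,\lambda)$ then $x=y$ or $\vartheta(\lambda)<n(\gamma)$ (this is the interpretation in the model of "$\varphi(x,\kappa)\wedge\varphi(y,\kappa)$ implies $(\triangleright^\kappa)^{n}(x=y)$"). Then for every $(\mathcal{E},\vartheta)$ and $\gamma\in\Gamma(\mathcal{E},\vartheta)$ the following are equivalent: (A) there exists $x\in X(\mathcal{E},\vartheta,\gamma)$ such that for all $\alpha<\rho$, $\star\in\varphi(\mathcal{E}\cup\{\lambda_\mathcal{E}\},\vartheta[\lambda_\mathcal{E}\mapsto\alpha],\iota\cdot\gamma,\iota\cdot x,\lambda_\mathcal{E})$; (B) for all $\alpha<\rho$ there exists $x\in X(\mathcal{E}\cup\{\lambda_\mathcal{E}\},\vartheta[\lambda_\mathcal{E}\mapsto\alpha],\iota\cdot\gamma)$ such that $\star\in\varphi(\mathcal{E}\cup\{\lambda_\mathcal{E}\},\vartheta[\lambda_\mathcal{E}\mapsto\alpha],\iota\cdot\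gamma,x,\lambda_\mathcal{E})$.
   Context: Fix a limit ordinal $\rho$ and a countably infinite set of clock names. The category $\mathbb{T}$ has objects pairs $(\mathcal{E},\vartheta)$ with $\mathcal{E}$ a finite set of clock names and $\vartheta:\mathcal{E}\to\rho$; a morphism $(\mathcal{E},\vartheta)\to(\mathcal{E}',\vartheta')$ is a function $\sigma:\mathcal{E}\to\mathcal{E}'$ with $\vartheta'\circ\sigma\le\vartheta$ pointwise. A presheaf on $\mathbb{T}$ is a covariant functor $\mathbb{T}\to\mathsf{Set}$; write $\sigma\cdot x$ for the action of $\sigma$. $\mathrm{Clk}$ is the presheaf $\mathrm{Clk}(\mathcal{E},\vartheta)=\mathcal{E}$ with $\sigma\cdot\lambda=\sigma(\lambda)$. For a presheaf $\Gamma$, $\int\Gamma$ is its category of elements, with objects $(\mathcal{E},\vartheta,\gamma)$; a presheaf $X$ over $\int\Gamma$ is a covariant functor $\int\Gamma\to\mathsf{Set}$ with fibres $X(\mathcal{E},\vartheta,\gamma)$ and maps $\sigma\cdot(-)$. $X$ is invariant under clock introduction if for all $(\mathcal{E},\vartheta)$, $\gamma$, clock names $\lambda\notin\mathcal{E}$ and $\alpha<\rho$, the map $\iota\cdot(-): X(\mathcal{E},\vartheta,\gamma)\to X(\mathcal{E}\cup\{\lambda\},\vartheta[\lambda\mapsto\alpha],\iota\cdot\gamma)$ induced by the inclusion $\iota:\mathcal{E}\to\mathcal{E}\cup\{\lambda\}$ is a bijection. A family over $\Gamma$ is a presheaf over $\int\Gamma$ invariant under clock introduction; a predicate is a family all of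 whose fibres are subsets of $\{\star\}$. The comprehension $\Gamma.X$ is the presheaf $(\Gamma.X)(\mathcal{E},\vartheta)=\{(\gamma,x)\mid\gamma\in\Gamma(\mathcal{E},\vartheta), x\in X(\mathcal{E},\vartheta,\gamma)\}$; thus a predicate $\varphi$ over $(\Gamma.X)\times\mathrm{Clk}$ has fibres $\varphi(\mathcal{E},\vartheta,\gamma,x,\lambda)\subseteq\{\star\}$ for $\lambda\in\mathcal{E}$. A function assigning to each finite set $\mathcal{E}$ of clock names a clock name $\lambda_\mathcal{E}\notin\mathcal{E}$ is fixed, and $\iota$ denotes the inclusion $\mathcal{E}\to\mathcal{E}\cup\{\lambda_\mathcal{E}\}$, viewed as a morphism $(\mathcal{E},\vartheta)\to(\mathcal{E}\cup\{\lambda_\mathcal{E}\},\vartheta[\lambda_\mathcal{E}\mapsto\alpha])$. -}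

module Defs where

open import Level using (Level; _⊔_; 0ℓ) renaming (suc to lsuc)
open import Data.Empty using (⊥-elim-irr)
open import Data.Irrelevant using ([_])
open import Data.List.Base using (List; _∷_)
open import Data.List.Membership.Propositional using () renaming (_∈_ to _∈ˡ_)
open import Data.List.Relation.Unary.Any using (here; there)
open import Data.Nat.Base using (ℕ) renaming (zero to ℕ-zero; suc to ℕ-suc)
import Data.Nat.Properties as ℕₚ
open import Data.Product.Base using (Σ; ∃; _×_; _,_; proj₁; proj₂)
open import Data.Product.Relation.Binary.Pointwise.NonDependent using (×-setoid)
open import Data.Refinement.Base using (Refinement; value; _,_)
open import Data.Sum.Base using (inj₁; inj₂; [_,_]′)
open import Data.Unit.Base using (⊤)
open import Function.Base using (id; _∘′_)
open import Function.Bundles using (Func; _⇔_; _⤖_; mk⇔; module Equivalence; module Bijection)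
import Function.Construct.Composition as Composition
import Function.Construct.Identity as Identity
open import Function.Definitions using (Bijective)
open import Induction.WellFounded using (WellFounded)
open import Relation.Binary.Bundles using (Setoid; StrictTotalOrder)
import Relation.Binary.Construct.On as On
import Relation.Binary.Construct.StrictToNonStrict as NonStrict
open import Relation.Binary.Definitions using (DecidableEquality)
open import Relation.Binary.PropositionalEquality as ≡ using (_≡_; refl)
open import Relation.Binary.Structures using (IsEquivalence)
open import Relation.Nullary using (¬_; yes; no)
open import Relation.Nullary.Decidable using (via-injection)
open import Relation.Nullary.Negation using (contradiction)
open import Relation.Unary using (Pred; _∈_; _∉_; _∪_; ｛_｝; _≐_)

open Func using (to; cong)

-- The set of ordinals below a limit ordinal ρ: a well-order that is
-- nonempty and closed under successor.  Zero and successor are operations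
-- because constructively they cannot be extracted from well-foundedness.

record LimitOrdinal (a ℓ₁ ℓ₂ : Level) : Set (lsuc (a ⊔ ℓ₁ ⊔ ℓ₂)) where
  field
    strictTotalOrder : StrictTotalOrder a ℓ₁ ℓ₂

  open StrictTotalOrder strictTotalOrder public
    using (Carrier; _≈_; _<_; isStrictTotalOrder; module Eq; <-resp-≈; compare)
    renaming (trans to <-trans; irrefl to <-irrefl)

  field
    <-wellFounded : WellFounded _<_
    zero          : Carrier
    zero-least    : ∀ α → ¬ (α < zero)
    suc           : Carrier → Carrier
    <-suc         : ∀ α → α < suc α
    suc-least     : ∀ {α β} → α < β → ¬ (β < suc α)

  open NonStrict _≈_ _<_ public using (_≤_)

  ≤-refl : ∀ {α} → α ≤ α
  ≤-refl = inj₂ Eq.refl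

  ≤-trans : ∀ {α β γ} → α ≤ β → β ≤ γ → α ≤ γ
  ≤-trans = NonStrict.trans _≈_ _<_ Eq.isEquivalence <-resp-≈ <-trans

  fromℕ : ℕ → Carrier
  fromℕ ℕ-zero    = zero
  fromℕ (ℕ-suc n) = suc (fromℕ n)

-- Sets are setoids throughout: hom-sets carry an equality, and the
-- category of sets is that of setoids and equality-preserving functions.

record Category (o m e : Level) : Set (lsuc (o ⊔ m ⊔ e)) where
  infix  4 _≈_ _⇒_
  infixr 9 _∘_
  field
    Obj       : Set o
    _⇒_       : Obj → Obj → Set m
    _≈_       : ∀ {A B} → A ⇒ B → A ⇒ B → Set e
    idₘ       : ∀ {A} → A ⇒ A
    _∘_       : ∀ {A B C} → B ⇒ C → A ⇒ B → A ⇒ C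
    equiv     : ∀ {A B} → IsEquivalence (_≈_ {A} {B})
    ∘-cong    : ∀ {A B C} {f f′ : B ⇒ C} {g g′ : A ⇒ B} →
                f ≈ f′ → g ≈ g′ → f ∘ g ≈ f′ ∘ g′
    identityˡ : ∀ {A B} (f : A ⇒ B) → idₘ ∘ f ≈ f
    identityʳ : ∀ {A B} (f : A ⇒ B) → f ∘ idₘ ≈ f
    assoc     : ∀ {A B C D} (f : C ⇒ D) (g : B ⇒ C) (h : A ⇒ B) →
                (f ∘ g) ∘ h ≈ f ∘ (g ∘ h)

-- Presheaves are covariant.

record IsPresheaf {o m e c ℓ} (C : Category o m e)
                  (F₀ : Category.Obj C → Setoid c ℓ) :
                  Set (o ⊔ m ⊔ e ⊔ c ⊔ ℓ) where
  private
    module C = Category C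
    module F₀ A = Setoid (F₀ A)
  field
    F₁       : ∀ {A B} → A C.⇒ B → Func (F₀ A) (F₀ B)
    F₁-cong  : ∀ {A B} {f g : A C.⇒ B} → f C.≈ g →
               ∀ x → F₀._≈_ B (to (F₁ f) x) (to (F₁ g) x)
    F₁-id    : ∀ {A} x → F₀._≈_ A (to (F₁ C.idₘ) x) x
    F₁-∘     : ∀ {A B D} (f : B C.⇒ D) (g : A C.⇒ B) →
               ∀ x → F₀._≈_ D (to (F₁ (f C.∘ g)) x) (to (F₁ f) (to (F₁ g) x))

  infixr 8 _·_
  _·_ : ∀ {A B} → A C.⇒ B → F₀.Carrier A → F₀.Carrier B
  f · x = to (F₁ f) x

record Presheaf {o m e} (C : Category o m e) (c ℓ : Level) :
                Set (o ⊔ m ⊔ e ⊔ lsuc (c ⊔ ℓ)) where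
  field
    F₀         : Category.Obj C → Setoid c ℓ
    isPresheaf : IsPresheaf C F₀
  open IsPresheaf isPresheaf public
  module F₀ A = Setoid (F₀ A)

  El : Category.Obj C → Set c
  El = F₀.Carrier

module _ {o m e} {C : Category o m e} where

  private module C = Category C

  record _⇛_ {c ℓ c′ ℓ′} (F : Presheaf C c ℓ) (G : Presheaf C c′ ℓ′) :
             Set (o ⊔ m ⊔ c ⊔ ℓ ⊔ c′ ⊔ ℓ′) where
    private
      module F = Presheaf F
      module G = Presheaf G
    field
      component : ∀ A → Func (F.F₀ A) (G.F₀ A)
      natural   : ∀ {A B} (f : A C.⇒ B) x →
                  G.F₀._≈_ B (to (component B) (f F.· x)) (f G.· to (component A) x)

  infix 20 _⟨_⟩_
  _⟨_⟩_ : ∀ {c ℓ c′ ℓ′} {F : Presheaf C c ℓ} {G : Presheaf C c′ ℓ′} →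
          F ⇛ G → ∀ A → Presheaf.El F A → Presheaf.El G A
  n ⟨ A ⟩ x = to (_⇛_.component n A) x

  Const : ∀ {c ℓ} → Setoid c ℓ → Presheaf C c ℓ
  Const S = record
    { F₀         = λ _ → S
    ; isPresheaf = record
      { F₁      = λ _ → Identity.function S
      ; F₁-cong = λ _ _ → Setoid.refl S
      ; F₁-id   = λ _ → Setoid.refl S
      ; F₁-∘    = λ _ _ _ → Setoid.refl S
      }
    }

  infixr 6 _×ᵖ_
  _×ᵖ_ : ∀ {c ℓ c′ ℓ′} → Presheaf C c ℓ → Presheaf C c′ ℓ′ →
         Presheaf C (c ⊔ c′) (ℓ ⊔ ℓ′)
  F ×ᵖ G = record
    { F₀         = λ A → ×-setoid (F.F₀ A) (G.F₀ A)
    ; isPresheaf = record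
      { F₁      = λ f → record
        { to   = λ (x , y) → f F.· x , f G.· y
        ; cong = λ (p , q) → cong (F.F₁ f) p , cong (G.F₁ f) q
        }
      ; F₁-cong = λ p (x , y) → F.F₁-cong p x , G.F₁-cong p y
      ; F₁-id   = λ (x , y) → F.F₁-id x , G.F₁-id y
      ; F₁-∘    = λ f g (x , y) → F.F₁-∘ f g x , G.F₁-∘ f g y
      }
    }
    where
    module F = Presheaf F
    module G = Presheaf G

  ∫ : ∀ {c ℓ} → Presheaf C c ℓ → Category (o ⊔ c) (m ⊔ ℓ) e
  ∫ Γ = record
    { Obj       = Σ C.Obj Γ.El
    ; _⇒_       = λ (A , γ) (B , δ) → Σ (A C.⇒ B) λ f → Γ.F₀._≈_ B (f Γ.· γ) δ
    ; _≈_       = λ f g → proj₁ f C.≈ proj₁ g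
    ; idₘ       = C.idₘ , Γ.F₁-id _
    ; _∘_       = λ {_} {_} {(D , _)} (f , p) (g , q) →
                    f C.∘ g ,
                    Γ.F₀.trans D (Γ.F₁-∘ f g _) (Γ.F₀.trans D (cong (Γ.F₁ f) q) p)
    ; equiv     = On.isEquivalence proj₁ C.equiv
    ; ∘-cong    = C.∘-cong
    ; identityˡ = λ f → C.identityˡ (proj₁ f)
    ; identityʳ = λ f → C.identityʳ (proj₁ f)
    ; assoc     = λ f g h → C.assoc (proj₁ f) (proj₁ g) (proj₁ h)
    }
    where module Γ = Presheaf Γ

  -- The morphism of ∫ Γ from γ to f · γ lying over f.
  lift : ∀ {c ℓ} (Γ : Presheaf C c ℓ) {A B} (f : A C.⇒ B) (γ : Presheaf.El Γ A) →
         Category._⇒_ (∫ Γ) (A , γ) (B , Presheaf._·_ Γ f γ)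
  lift Γ {B = B} f γ = f , Presheaf.F₀.refl Γ B

  -- Comprehension Γ.X.  Elements of X in the fibres over equal γ and γ′ are
  -- compared by transport along the identity, regarded as a morphism γ ⇒ γ′.
  comprehension : ∀ {c ℓ d k} (Γ : Presheaf C c ℓ) → Presheaf (∫ Γ) d k →
                  Presheaf C (c ⊔ d) (ℓ ⊔ k)
  comprehension {c} {ℓ} {d} {k} Γ X = record
    { F₀         = fibre
    ; isPresheaf = record
      { F₁      = λ {A} {B} f → record
        { to   = λ (γ , x) → f Γ.· γ , lift Γ f γ X.· x
        ; cong = λ {_} {(_ , y)} (p , q) →
            cong (Γ.F₁ f) p ,
            X.F₀.trans _ (X.F₀.sym _ (X.F₁-∘ _ _ _))
              (X.F₀.trans _ (X.F₁-cong (id-comm f) _)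
                (X.F₀.trans _ (X.F₁-∘ (lift Γ f _) (over p) _)
                  (cong (X.F₁ _) q)))
        }
      ; F₁-cong = λ {_} {B} {f} {g} p (γ , x) →
          Γ.F₁-cong p γ ,
          X.F₀.trans _ (X.F₀.sym _ (X.F₁-∘ _ _ _))
            (X.F₁-cong (trans (C.identityˡ f) p) _)
      ; F₁-id   = λ (γ , x) →
          Γ.F₁-id γ ,
          X.F₀.trans _ (X.F₀.sym _ (X.F₁-∘ _ _ _))
            (X.F₀.trans _ (X.F₁-cong (C.identityˡ C.idₘ) x) (X.F₁-id x))
      ; F₁-∘    = λ f g (γ , x) →
          Γ.F₁-∘ f g γ ,
          X.F₀.trans _ (X.F₀.sym _ (X.F₁-∘ _ _ _))
            (X.F₀.trans _ (X.F₁-cong (C.identityˡ (f C.∘ g)) x)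
              (X.F₁-∘ (lift Γ f _) (lift Γ g γ) x))
      }
    }
    where
    module Γ = Presheaf Γ
    module X = Presheaf X
    module E = Category (∫ Γ)

    trans : ∀ {A B} {f g h : A C.⇒ B} → f C.≈ g → g C.≈ h → f C.≈ h
    trans = IsEquivalence.trans C.equiv

    sym : ∀ {A B} {f g : A C.⇒ B} → f C.≈ g → g C.≈ f
    sym = IsEquivalence.sym C.equiv

    id-comm : ∀ {A B} (f : A C.⇒ B) → C.idₘ C.∘ f C.≈ f C.∘ C.idₘ
    id-comm f = trans (C.identityˡ f) (sym (C.identityʳ f))

    over : ∀ {A} {γ γ′ : Γ.El A} → Γ.F₀._≈_ A γ γ′ → (A , γ) E.⇒ (A , γ′)
    over {A} p = C.idₘ , Γ.F₀.trans A (Γ.F₁-id _) p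

    _≋_ : ∀ {A} → Σ (Γ.El A) (λ γ → X.El (A , γ)) →
          Σ (Γ.El A) (λ γ → X.El (A , γ)) → Set (ℓ ⊔ k)
    _≋_ {A} (γ , x) (γ′ , x′) =
      Σ (Γ.F₀._≈_ A γ γ′) λ p → X.F₀._≈_ (A , γ′) (over p X.· x) x′

    fibre : C.Obj → Setoid (c ⊔ d) (ℓ ⊔ k)
    fibre A = record
      { Carrier       = Σ (Γ.El A) λ γ → X.El (A , γ)
      ; _≈_           = _≋_
      ; isEquivalence = record
        { refl  = Γ.F₀.refl A ,
                  X.F₀.trans _ (X.F₁-cong (IsEquivalence.refl C.equiv) _) (X.F₁-id _)
        ; sym   = λ (p , q) →
            Γ.F₀.sym A p ,
            X.F₀.trans _ (cong (X.F₁ _) (X.F₀.sym _ q))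
              (X.F₀.trans _ (X.F₀.sym _ (X.F₁-∘ _ (over p) _))
                (X.F₀.trans _ (X.F₁-cong (C.identityˡ C.idₘ) _) (X.F₁-id _)))
        ; trans = λ (p , q) (p′ , q′) →
            Γ.F₀.trans A p p′ ,
            X.F₀.trans _ (X.F₁-cong (sym (C.identityˡ C.idₘ)) _)
              (X.F₀.trans _ (X.F₁-∘ (over p′) (over p) _)
                (X.F₀.trans _ (cong (X.F₁ _) q) q′))
        }
      }

module Clocks {a ℓ₁ ℓ₂} (ρ : LimitOrdinal a ℓ₁ ℓ₂)
              (Name : Set) (countablyInfinite : Name ⤖ ℕ) where

  private module ρ = LimitOrdinal ρ

  _≟_ : DecidableEquality Name
  _≟_ = via-injection (Bijection.injection countablyInfinite) ℕₚ._≟_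

  record FiniteSet : Set₁ where
    constructor mkFiniteSet
    field
      members : Pred Name 0ℓ
      finite  : ∃ λ (xs : List Name) → ∀ x → x ∈ members ⇔ x ∈ˡ xs

  open FiniteSet public

  infixl 6 _∪｛_｝
  _∪｛_｝ : FiniteSet → Name → FiniteSet
  𝓔 ∪｛ κ ｝ = mkFiniteSet (members 𝓔 ∪ ｛ κ ｝) (κ ∷ xs , λ x → mk⇔ (⇒ x) (⇐ x))
    where
    xs = proj₁ (finite 𝓔)

    ⇒ : ∀ x → x ∈ members 𝓔 ∪ ｛ κ ｝ → x ∈ˡ κ ∷ xs
    ⇒ x (inj₁ x∈𝓔) = there (Equivalence.to (proj₂ (finite 𝓔) x) x∈𝓔)
    ⇒ x (inj₂ κ≡x) = here (≡.sym κ≡x)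

    ⇐ : ∀ x → x ∈ˡ κ ∷ xs → x ∈ members 𝓔 ∪ ｛ κ ｝
    ⇐ x (here x≡κ)   = inj₂ (≡.sym x≡κ)
    ⇐ x (there x∈xs) = inj₁ (Equivalence.from (proj₂ (finite 𝓔) x) x∈xs)

  -- Membership proofs are irrelevant, so elements are equal as soon as
  -- they have the same name.
  Clock : FiniteSet → Set
  Clock 𝓔 = Refinement Name (members 𝓔)

  record Obj : Set (lsuc 0ℓ ⊔ a) where
    constructor _,_
    field
      clocks : FiniteSet
      time   : Clock clocks → ρ.Carrier

  open Obj public

  record _⟶_ (A B : Obj) : Set (ℓ₁ ⊔ ℓ₂) where
    field
      fun   : Clock (clocks A) → Clock (clocks B)
      fun-≤ : ∀ κ → time B (fun κ) ρ.≤ time A κ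

  open _⟶_ public

  𝕋 : Category (lsuc 0ℓ ⊔ a) (ℓ₁ ⊔ ℓ₂) 0ℓ
  𝕋 = record
    { Obj       = Obj
    ; _⇒_       = _⟶_
    ; _≈_       = λ σ τ → ∀ κ → fun σ κ ≡ fun τ κ
    ; idₘ       = record { fun = id ; fun-≤ = λ _ → ρ.≤-refl }
    ; _∘_       = λ σ τ → record
      { fun   = fun σ ∘′ fun τ
      ; fun-≤ = λ κ → ρ.≤-trans (fun-≤ σ (fun τ κ)) (fun-≤ τ κ)
      }
    ; equiv     = record
      { refl  = λ _ → refl
      ; sym   = λ p κ → ≡.sym (p κ)
      ; trans = λ p q κ → ≡.trans (p κ) (q κ)
      }
    ; ∘-cong    = λ {_} {_} {_} {f} p q κ → ≡.trans (≡.cong (fun f) (q κ)) (p _)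
    ; identityˡ = λ _ _ → refl
    ; identityʳ = λ _ _ → refl
    ; assoc     = λ _ _ _ _ → refl
    }

  Clk : Presheaf 𝕋 0ℓ 0ℓ
  Clk = record
    { F₀         = λ A → ≡.setoid (Clock (clocks A))
    ; isPresheaf = record
      { F₁      = λ σ → record { to = fun σ ; cong = ≡.cong (fun σ) }
      ; F₁-cong = λ p → p
      ; F₁-id   = λ _ → refl
      ; F₁-∘    = λ _ _ _ → refl
      }
    }

  _[_↦_] : ∀ {𝓔} → (Clock 𝓔 → ρ.Carrier) → (κ : Name) → ρ.Carrier →
           Clock (𝓔 ∪｛ κ ｝) → ρ.Carrier
  _[_↦_] ϑ κ α (x , [ x∈ ]) with x ≟ κ
  ... | yes _  = α
  ... | no x≢κ = ϑ (x , [ [ id , (λ κ≡x → contradiction (≡.sym κ≡x) x≢κ) ]′ x∈ ])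

  extend : Obj → Name → ρ.Carrier → Obj
  extend (𝓔 , ϑ) κ α = 𝓔 ∪｛ κ ｝ , _[_↦_] {𝓔} ϑ κ α

  newClock : ∀ 𝓔 κ → Clock (𝓔 ∪｛ κ ｝)
  newClock 𝓔 κ = κ , [ inj₂ refl ]

  ι : ∀ (A : Obj) {κ} → κ ∉ members (clocks A) → ∀ α → A ⟶ extend A κ α
  ι (𝓔 , ϑ) {κ} κ∉𝓔 α = record { fun = incl ; fun-≤ = incl-≤ }
    where
    incl : Clock 𝓔 → Clock (𝓔 ∪｛ κ ｝)
    incl (x , [ x∈𝓔 ]) = x , [ inj₁ x∈𝓔 ]

    incl-≤ : ∀ x → time (extend (𝓔 , ϑ) κ α) (incl x) ρ.≤ ϑ x
    incl-≤ (x , [ x∈𝓔 ]) with x ≟ κ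
    ... | yes refl = ⊥-elim-irr (κ∉𝓔 x∈𝓔)
    ... | no _ = ρ.≤-refl

  record IsFamily {c ℓ d k} (Γ : Presheaf 𝕋 c ℓ)
                  (X₀ : Category.Obj (∫ Γ) → Setoid d k) :
                  Set (lsuc 0ℓ ⊔ a ⊔ ℓ₁ ⊔ ℓ₂ ⊔ c ⊔ ℓ ⊔ d ⊔ k) where
    private module Γ = Presheaf Γ
    field
      isPresheaf : IsPresheaf (∫ Γ) X₀

    open IsPresheaf isPresheaf

    field
      invariant : ∀ (A : Obj) (γ : Γ.El A) {κ} (κ∉ : κ ∉ members (clocks A)) α →
                  Bijective (Setoid._≈_ (X₀ (A , γ)))
                            (Setoid._≈_ (X₀ (extend A κ α , ι A κ∉ α Γ.· γ)))
                            (lift Γ (ι A κ∉ α) γ ·_)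

  record Family {c ℓ} (Γ : Presheaf 𝕋 c ℓ) (d k : Level) :
                Set (lsuc 0ℓ ⊔ a ⊔ ℓ₁ ⊔ ℓ₂ ⊔ c ⊔ ℓ ⊔ lsuc (d ⊔ k)) where
    field
      X₀       : Category.Obj (∫ Γ) → Setoid d k
      isFamily : IsFamily Γ X₀

    open IsFamily isFamily public using (invariant)

    presheaf : Presheaf (∫ Γ) d k
    presheaf = record { F₀ = X₀ ; isPresheaf = IsFamily.isPresheaf isFamily }

    open Presheaf presheaf public

  -- The subset P of {⋆} as a set.
  subset : ∀ {p} → Pred ⊤ p → Setoid p 0ℓ
  subset P = On.setoid {B = Σ ⊤ P} (≡.setoid ⊤) proj₁

  record Predicate {c ℓ} (Γ : Presheaf 𝕋 c ℓ) (p : Level) :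
                   Set (lsuc 0ℓ ⊔ a ⊔ ℓ₁ ⊔ ℓ₂ ⊔ c ⊔ ℓ ⊔ lsuc p) where
    field
      fibre    : ∀ A → Presheaf.El Γ A → Pred ⊤ p
      isFamily : IsFamily Γ λ (A , γ) → subset (fibre A γ)

  infixl 5 _▷_
  _▷_ : ∀ {c ℓ d k} (Γ : Presheaf 𝕋 c ℓ) → Family Γ d k → Presheaf 𝕋 (c ⊔ d) (ℓ ⊔ k)
  Γ ▷ X = comprehension Γ (Family.presheaf X)

  -- 𝓔 ↦ λ_𝓔; the last field makes the choice depend only on the set 𝓔,
  -- not on its presentation.
  record FreshNames : Set₁ where
    field
      fresh      : FiniteSet → Name
      fresh-∉    : ∀ 𝓔 → fresh 𝓔 ∉ members 𝓔
      fresh-cong : ∀ {𝓔 𝓔′} → members 𝓔 ≐ members 𝓔′ → fresh 𝓔 ≡ fresh 𝓔′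

    infix 7 _⁺_
    _⁺_ : Obj → ρ.Carrier → Obj
    A ⁺ α = extend A (fresh (clocks A)) α

    ι⁺ : ∀ A α → A ⟶ (A ⁺ α)
    ι⁺ A α = ι A (fresh-∉ (clocks A)) α

    κ⁺ : ∀ A → Clock (clocks A ∪｛ fresh (clocks A) ｝)
    κ⁺ A = newClock (clocks A) (fresh (clocks A))

{-# OPTIONS --safe #-}

-- Clock introduction lets us pull a witness at every stage α back to an
-- element y α of X (A , γ).  At stage N = n γ the hypothesis makes witnesses
-- unique, since the new clock then has time exactly N.  So y N is the required
-- element: for α ≤ N its property restricts from N to α, and for α > N the
-- property of y α restricts from α to N, which forces y α ≈ y N.

module Submission where

open import Defs
open import Level using (Level)
open import Data.Empty using (⊥-elim)
open import Data.Nat.Base using (ℕ)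
open import Data.Product.Base using (∃; _,_; proj₁; proj₂)
open import Data.Refinement.Base using (_,_)
open import Data.Sum.Base using (_⊎_; inj₁; inj₂)
open import Data.Unit.Base using () renaming (tt to ⋆)
open import Function.Bundles using (_⇔_; _⤖_; mk⇔; module Func)
open import Relation.Binary.Definitions using (tri<; tri≈; tri>)
open import Relation.Binary.PropositionalEquality using (_≡_; refl; cong; subst₂; setoid)
open import Relation.Nullary using (yes; no; contradiction)
open import Relation.Unary using (_∈_; _∉_)

module _ {a ℓ₁ ℓ₂} (ρ : LimitOrdinal a ℓ₁ ℓ₂)
         (Name : Set) (countablyInfinite : Name ⤖ ℕ) where

  private module ρ = LimitOrdinal ρ
  open Clocks ρ Name countablyInfinite

  time-newClock : ∀ A κ α → time (extend A κ α) (newClock (clocks A) κ) ≡ α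
  time-newClock A κ α with κ ≟ κ
  ... | yes _  = refl
  ... | no κ≢κ = contradiction refl κ≢κ

  -- Morphisms of `𝕋` may only lower times, so the identity on clocks leads from the later stage `β`
  -- to the earlier stage `α`.
  extend-mono : ∀ A κ {α β} → α ρ.≤ β → extend A κ β ⟶ extend A κ α
  extend-mono A κ {α} {β} α≤β = record { fun = λ x → x ; fun-≤ = decreasing }
    where
    decreasing : ∀ x → time (extend A κ α) x ρ.≤ time (extend A κ β) x
    decreasing (x , _) with x ≟ κ
    ... | yes _ = α≤β
    ... | no _  = ρ.≤-refl

  -- The functorial action carries a proof at `γ` to one at `σ · γ`; taking the target up to `≈`
  -- allows any convenient representative `δ`.
  Predicate-map : ∀ {c ℓ p} {Γ : Presheaf 𝕋 c ℓ} (φ : Predicate Γ p) →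
                  let module Γ = Presheaf Γ
                      module φ = Predicate φ
                  in
                  ∀ {A B γ δ} (σ : A ⟶ B) → Γ.F₀._≈_ B (σ Γ.· γ) δ →
                  ⋆ ∈ φ.fibre A γ → ⋆ ∈ φ.fibre B δ
  Predicate-map φ σ σγ≈δ holds =
    proj₂ (IsPresheaf._·_ (IsFamily.isPresheaf (Predicate.isFamily φ)) (σ , σγ≈δ) (⋆ , holds))

  module _ {c ℓ d k p} (Γ : Presheaf 𝕋 c ℓ) (X : Family Γ d k)
           (φ : Predicate ((Γ ▷ X) ×ᵖ Clk) p) where

    private
      module Γ = Presheaf Γ
      module X = Family X
      module φ = Predicate φ

    -- Predicate fibres are indexed by representatives, so invariance under `≈` comes from
    -- functoriality: an equality of elements is a morphism of the category of elements lying over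
    -- the identity.
    fibre-resp-≈ : ∀ {A} {γ : Γ.El A} {x y : X.El (A , γ)} {κ : Clock (clocks A)} →
                   X.F₀._≈_ (A , γ) x y →
                   ⋆ ∈ φ.fibre A ((γ , x) , κ) → ⋆ ∈ φ.fibre A ((γ , y) , κ)
    fibre-resp-≈ {A} {γ} {x} {y} {κ} x≈y =
      Predicate-map φ (Category.idₘ 𝕋)
        (Γ▷X.F₀.trans A {i = Category.idₘ 𝕋 Γ▷X.· (γ , x)} {j = γ , x} {k = γ , y}
          (Γ▷X.F₁-id (γ , x))
          (Γ.F₀.refl A ,
           X.F₀.trans _ (X.F₁-cong (λ _ → refl) x) (X.F₀.trans _ (X.F₁-id x) x≈y))
        , refl)
      where module Γ▷X = Presheaf (Γ ▷ X)

    fibre-extend-mono : ∀ A {κ} (κ∉ : κ ∉ members (clocks A)) (γ : Γ.El A) (x : X.El (A , γ)) →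
                        let holds = λ α → ⋆ ∈ φ.fibre (extend A κ α)
                              ((ι A κ∉ α Γ.· γ , lift Γ (ι A κ∉ α) γ X.· x) , newClock (clocks A) κ)
                        in ∀ {α β} → α ρ.≤ β → holds β → holds α
    fibre-extend-mono A {κ} κ∉ γ x {α} {β} α≤β =
      Predicate-map φ σ
        (Γ▷X.F₀.trans (extend A κ α)
          {i = σ Γ▷X.· (ι A κ∉ β Γ▷X.· (γ , x))} {j = (σ ∘ ι A κ∉ β) Γ▷X.· (γ , x)}
          {k = ι A κ∉ α Γ▷X.· (γ , x)}
          (Γ▷X.F₀.sym (extend A κ α)
            {x = (σ ∘ ι A κ∉ β) Γ▷X.· (γ , x)} {y = σ Γ▷X.· (ι A κ∉ β Γ▷X.· (γ , x))}
            (Γ▷X.F₁-∘ σ (ι A κ∉ β) (γ , x)))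
          -- `σ` fixes every clock, so both morphisms have the inclusion as underlying function; the
          -- final `refl` says that `σ` fixes the new clock.
          (Γ▷X.F₁-cong {f = σ ∘ ι A κ∉ β} {g = ι A κ∉ α} (λ _ → refl) (γ , x))
        , refl)
      where
      open Category 𝕋 using (_∘_)
      module Γ▷X = Presheaf (Γ ▷ X)
      σ = extend-mono A κ α≤β

mainTheorem6 :
  ∀ {a ℓ₁ ℓ₂ c ℓ d k p : Level}
  (ρ : LimitOrdinal a ℓ₁ ℓ₂) (Name : Set) (countablyInfinite : Name ⤖ ℕ) →
  let module ρ = LimitOrdinal ρ
      open Clocks ρ Name countablyInfinite
  in
  (freshNames : FreshNames) →
  let open FreshNames freshNames
  in
  (Γ : Presheaf 𝕋 c ℓ)
  (X : Family Γ d k)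
  (φ : Predicate ((Γ ▷ X) ×ᵖ Clk) p)
  (n : Γ ⇛ Const (setoid ℕ)) →
  let module Γ = Presheaf Γ
      module X = Family X
      module φ = Predicate φ
  in
  (∀ A (γ : Γ.El A) (x y : X.El (A , γ)) (κ : Clock (clocks A)) →
     ⋆ ∈ φ.fibre A ((γ , x) , κ) →
     ⋆ ∈ φ.fibre A ((γ , y) , κ) →
     X.F₀._≈_ (A , γ) x y ⊎ time A κ ρ.< ρ.fromℕ (n ⟨ A ⟩ γ)) →
  ∀ A (γ : Γ.El A) →
    (∃ λ (x : X.El (A , γ)) → ∀ α →
       ⋆ ∈ φ.fibre (A ⁺ α) ((ι⁺ A α Γ.· γ , lift Γ (ι⁺ A α) γ X.· x) , κ⁺ A))
    ⇔
    (∀ α → ∃ λ (x : X.El (A ⁺ α , ι⁺ A α Γ.· γ)) →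
       ⋆ ∈ φ.fibre (A ⁺ α) ((ι⁺ A α Γ.· γ , x) , κ⁺ A))
mainTheorem6 ρ Name countablyInfinite freshNames Γ X φ n unique A γ =
  mk⇔ (λ (x , holds) α → lift Γ (ι⁺ A α) γ X.· x , holds α)
      (λ witness → y witness N , y-holds witness)
  where
  module ρ = LimitOrdinal ρ
  open Clocks ρ Name countablyInfinite
  open FreshNames freshNames
  module Γ = Presheaf Γ
  module X = Family X
  module φ = Predicate φ

  N : ρ.Carrier
  N = ρ.fromℕ (n ⟨ A ⟩ γ)

  κ∉ = fresh-∉ (clocks A)

  Holds : X.El (A , γ) → ρ.Carrier → Set _
  Holds x α = ⋆ ∈ φ.fibre (A ⁺ α) ((ι⁺ A α Γ.· γ , lift Γ (ι⁺ A α) γ X.· x) , κ⁺ A)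

  unique-at-N : ∀ {x x′} → Holds x N → Holds x′ N → X.F₀._≈_ (A , γ) x x′
  unique-at-N h h′ with unique (A ⁺ N) _ _ _ (κ⁺ A) h h′
  -- Injectivity of clock introduction brings the equality down from `A ⁺ N` to `A`.
  ... | inj₁ ιx≈ιx′ = proj₁ (X.invariant A γ κ∉ N) ιx≈ιx′
  -- Naturality of `n` into a constant presheaf gives `ι⁺ A N · γ` the same value as `γ`, so
  -- `time<n` becomes `N < N`.
  ... | inj₂ time<n = ⊥-elim (ρ.<-irrefl ρ.Eq.refl
    (subst₂ ρ._<_ (time-newClock ρ Name countablyInfinite A (fresh (clocks A)) N)
                  (cong ρ.fromℕ (_⇛_.natural n (ι⁺ A N) γ))
                  time<n))

  module _ (witness : ∀ α → ∃ λ (x : X.El (A ⁺ α , ι⁺ A α Γ.· γ)) →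
                        ⋆ ∈ φ.fibre (A ⁺ α) ((ι⁺ A α Γ.· γ , x) , κ⁺ A)) where

    y : ρ.Carrier → X.El (A , γ)
    y α = proj₁ (proj₂ (X.invariant A γ κ∉ α) (proj₁ (witness α)))

    diagonal : ∀ α → Holds (y α) α
    diagonal α = fibre-resp-≈ ρ Name countablyInfinite Γ X φ
      -- By surjectivity of clock introduction, the image of `y α` at stage `α` is the given witness
      -- up to `≈`.
      (X.F₀.sym _ (proj₂ (proj₂ (X.invariant A γ κ∉ α) (proj₁ (witness α))) (X.F₀.refl _)))
      (proj₂ (witness α))

    restrict : ∀ x {α β} → α ρ.≤ β → Holds x β → Holds x α
    restrict = fibre-extend-mono ρ Name countablyInfinite Γ X φ A κ∉ γ

    y-holds : ∀ α → Holds (y N) α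
    y-holds α with ρ.compare α N
    ... | tri< α<N _ _ = restrict (y N) (inj₁ α<N) (diagonal N)
    -- Stages are equal only up to `≈`, so this case also needs a morphism, supplied by `restrict`.
    ... | tri≈ _ α≈N _ = restrict (y N) (inj₂ α≈N) (diagonal N)
    -- The equality found at stage `N` holds already over `A`, hence it can be pushed forward to
    -- stage `α`, where `y α` is known to satisfy `φ`.
    ... | tri> _ _ N<α = fibre-resp-≈ ρ Name countablyInfinite Γ X φ
      (Func.cong (X.F₁ (lift Γ (ι⁺ A α) γ))
        (unique-at-N (restrict (y α) (inj₁ N<α) (diagonal α)) (diagonal N)))
      (diagonal α)
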